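{- Let $G=(V,E)$ be a graph with countably infinite vertex set. The following are equivalent: (1) For every partition of $V$ into two infinite sets $V_1,V_2$, there exist $W_1\subseteq V_1$ and $W_2\subseteq V_2$ such that for $i=1,2$ every $v\in W_i$ has infinite degree in the induced subgraph $G[W_i]$, and there is an edge $w_1w_2\in E$ with $w_1\in W_1$, $w_2\in W_2$. (2) For every labeling of $V$ by $\mathbb{Z}$ there exists an infinite increasing two-sided path in $G$.
   Context: A labeling of $V$ by $\mathbb{Z}$ is a bijection $\phi:V\to\mathbb{Z}$. An infinite increasing two-sided path is a family of distinct vertices $(v_i)_{i\in\mathbb{Z}}$ with $v_iv_{i+1}\in E$ and $\phi(v_i)<\phi(v_{i+1})$ for all $i\in\mathbb{Z}$. -}

module Defs where

open import Level using (0ℓ)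
open import Data.Bool using (Bool; true; false)
open import Data.Nat using (ℕ)
open import Data.Integer as ℤ using (ℤ; _<_; 1ℤ)
open import Data.Product using (Σ; _×_; ∃; ∃-syntax; _,_)
open import Data.List using (List)
open import Data.List.Membership.Propositional using (_∈_)
open import Relation.Nullary using (¬_)
open import Relation.Binary.PropositionalEquality using (_≡_)
open import Function.Definitions using (Bijective; Injective)
open import Function.Bundles using (_⤖_)

record Graph (V : Set) : Set₁ where
  field
    E     : V → V → Set
    sym   : ∀ {u v} → E u v → E v u
    irrefl : ∀ {v} → ¬ E v v

CountablyInfinite : Set → Set
CountablyInfinite V = V ⤖ ℕ

Subset : Set → Set₁
Subset V = V → Set

_⊆_ : {V : Set} → Subset V → Subset V → Set
A ⊆ B = ∀ {v} → A v → B v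

Finite : {V : Set} → Subset V → Set
Finite {V} S = Σ (List V) λ xs → ∀ {v} → S v → v ∈ xs

Infinite : {V : Set} → Subset V → Set
Infinite S = ¬ Finite S

NbhdIn : {V : Set} → Graph V → Subset V → V → Subset V
NbhdIn G W v u = W u × Graph.E G v u

AllInfiniteDegree : {V : Set} → Graph V → Subset V → Set
AllInfiniteDegree G W = ∀ {v} → W v → Infinite (NbhdIn G W v)

-- Condition (1). A partition of V into two sets is given by a colouring
-- c : V → Bool, with V₁ = c⁻¹(true), V₂ = c⁻¹(false).
Condition1 : {V : Set} → Graph V → Set₁
Condition1 {V} G =
  (c : V → Bool) →
  Infinite (λ v → c v ≡ true) → Infinite (λ v → c v ≡ false) →
  Σ (Subset V) λ W₁ → Σ (Subset V) λ W₂ →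
    (W₁ ⊆ (λ v → c v ≡ true)) × (W₂ ⊆ (λ v → c v ≡ false)) ×
    AllInfiniteDegree G W₁ × AllInfiniteDegree G W₂ ×
    (∃[ w₁ ] ∃[ w₂ ] (W₁ w₁ × W₂ w₂ × Graph.E G w₁ w₂))

Labeling : Set → Set
Labeling V = Σ (V → ℤ) (Bijective _≡_ _≡_)

IncreasingTwoSidedPath : {V : Set} → Graph V → (V → ℤ) → Set
IncreasingTwoSidedPath {V} G φ =
  Σ (ℤ → V) λ p →
    Injective _≡_ _≡_ p ×
    (∀ i → Graph.E G (p i) (p (i ℤ.+ 1ℤ))) ×
    (∀ i → φ (p i) < φ (p (i ℤ.+ 1ℤ)))

Condition2 : {V : Set} → Graph V → Set
Condition2 {V} G = (φ : Labeling V) → IncreasingTwoSidedPath G (Data.Product.proj₁ φ)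

{-# OPTIONS --safe #-}

-- (1) ⇒ (2): colour by the sign of the label and walk greedily away from 0 in W₁ and in W₂,
-- starting from the edge between them.
-- (2) ⇒ (1): let Wᵢ be the largest subset of Vᵢ of infinite minimum degree.  It suffices to order Vᵢ
-- in type ω so that no increasing ray starts outside Wᵢ: the two-sided path then has to change
-- sides along an edge between W₁ and W₂.  The complement of Wᵢ is generated inductively by vertices
-- with finitely many neighbours not yet generated, so such an order is built by induction.
-- Adding one vertex is trivial (it goes first); for a countable union the orders are interleaved.
module Submission where

open import Defs
open import Level using (0ℓ)
open import Axiom.ExcludedMiddle using (ExcludedMiddle)
open import Data.Bool using (Bool; true; false)
open import Data.Empty using (⊥)
open import Data.Integer as ℤ using (ℤ; +_; -[1+_]; 0ℤ; 1ℤ; ∣_∣; +<+; -<+; -<-)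
import Data.Integer.Properties as ℤ
open import Data.List using (List; []; _∷_; map)
open import Data.List.Extrema.Nat using (max; xs≤max)
open import Data.List.Membership.Propositional using (_∈_; _∉_)
open import Data.List.Membership.Propositional.Properties using (∈-map⁺)
import Data.List.Relation.Unary.All as All
open import Data.List.Relation.Unary.Any using (here; there)
open import Data.Nat using (ℕ; zero; suc; _+_; _*_; _∸_; _⊔_; _⊓_; _≤_; _<_; z≤n; s≤s; s<s⁻¹; _≤′_; ≤′-refl; ≤′-step)
open import Data.Nat.Induction using (<-wellFounded)
open import Data.Nat.Properties
open import Data.Product using (Σ; _×_; ∃; ∃-syntax; _,_; proj₁; proj₂)
open import Data.Sum using (_⊎_; inj₁; inj₂; [_,_]′)
open import Function using (_∘_)
open import Function.Bundles using (_⇔_; mk⇔; module Bijection)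
open import Function.Definitions using (Injective)
open import Induction.WellFounded using (Acc; acc)
open import Relation.Binary.PropositionalEquality
open import Relation.Binary.Definitions using (tri<; tri≈; tri>)
open import Relation.Nullary using (¬_; yes; no; contradiction)
open import Relation.Nullary.Decidable using (decidable-stable)

-- Monotone sequences, running suprema and finite bounds

step⇒mono : (f : ℕ → ℕ) → (∀ n → f n ≤ f (suc n)) → ∀ {m n} → m ≤ n → f m ≤ f n
step⇒mono f f≤ m≤n = go (≤⇒≤′ m≤n)
  where
  go : ∀ {m n} → m ≤′ n → f m ≤ f n
  go ≤′-refl = ≤-refl
  go (≤′-step m≤′n) = ≤-trans (go m≤′n) (f≤ _)

step⇒injective : (f : ℕ → ℕ) → (∀ n → f n < f (suc n)) → Injective _≡_ _≡_ f
step⇒injective f f< {m} {n} fm≡fn with <-cmp m n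
... | tri≈ _ m≡n _ = m≡n
... | tri< m<n _ _ =
  contradiction fm≡fn (<⇒≢ (<-≤-trans (f< m) (step⇒mono f (<⇒≤ ∘ f<) m<n)))
... | tri> _ _ n<m =
  contradiction (sym fm≡fn) (<⇒≢ (<-≤-trans (f< n) (step⇒mono f (<⇒≤ ∘ f<) n<m)))

step⇒≥ : (f : ℕ → ℕ) → (∀ n → f n < f (suc n)) → ∀ n → n ≤ f n
step⇒≥ f f< zero    = z≤n
step⇒≥ f f< (suc n) = ≤-<-trans (step⇒≥ f f< n) (f< n)

sup : (ℕ → ℕ) → ℕ → ℕ
sup f zero    = f zero
sup f (suc n) = f (suc n) ⊔ sup f n

sup-step : ∀ f n → sup f n ≤ sup f (suc n)
sup-step f n = m≤n⊔m (f (suc n)) (sup f n)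

sup-upper : ∀ f {i n} → i ≤ n → f i ≤ sup f n
sup-upper f {i} i≤n = ≤-trans (self i) (step⇒mono (sup f) (sup-step f) i≤n)
  where
  self : ∀ i → f i ≤ sup f i
  self zero    = ≤-refl
  self (suc i) = m≤m⊔n (f (suc i)) (sup f i)

maxOver : {V : Set} → (V → ℕ) → List V → ℕ
maxOver f xs = max 0 (map f xs)

∈⇒≤maxOver : {V : Set} (f : V → ℕ) {x : V} {xs : List V} → x ∈ xs → f x ≤ maxOver f xs
∈⇒≤maxOver f {xs = xs} x∈xs = All.lookup (xs≤max 0 (map f xs)) (∈-map⁺ f x∈xs)

unbounded⇒infinite : {V : Set} {S : V → Set} (ν : V → ℕ) →
  (∀ n → ∃[ v ] (S v × n ≤ ν v)) → Infinite S
unbounded⇒infinite ν unbounded (xs , S⊆xs) with unbounded (suc (maxOver ν xs))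
... | v , Sv , max<νv = <⇒≱ max<νv (∈⇒≤maxOver ν (S⊆xs Sv))

-- Signs and absolute values of integers

isNonNegative : ℤ → Bool
isNonNegative (+ _)    = true
isNonNegative -[1+ _ ] = false

∣∣-injective : ∀ {y z} b → isNonNegative y ≡ b → isNonNegative z ≡ b → ∣ y ∣ ≡ ∣ z ∣ → y ≡ z
∣∣-injective {+ _}      {+ _}      true  _ _ eq = cong +_ eq
∣∣-injective { -[1+ _ ]} { -[1+ _ ]} false _ _ eq = cong -[1+_] (suc-injective eq)

∣∣<⇒< : ∀ {y z} → isNonNegative y ≡ true → isNonNegative z ≡ true → ∣ y ∣ < ∣ z ∣ → y ℤ.< z
∣∣<⇒< {+ _} {+ _} _ _ lt = +<+ lt

∣∣<⇒> : ∀ {y z} → isNonNegative y ≡ false → isNonNegative z ≡ false → ∣ y ∣ < ∣ z ∣ → z ℤ.< y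
∣∣<⇒> { -[1+ _ ]} { -[1+ _ ]} _ _ lt = -<- (s<s⁻¹ lt)

false<true : ∀ {y z} → isNonNegative y ≡ false → isNonNegative z ≡ true → y ℤ.< z
false<true { -[1+ _ ]} {+ _} _ _ = -<+

-- Thin vertices and tame sets

module _ {V : Set} (E : V → V → Set) where

  -- Complement of the largest set in which every vertex has infinitely many out-neighbours.
  data Thin : V → Set where
    thin : ∀ {v} (xs : List V) → (∀ u → E v u → u ∉ xs → Thin u) → Thin v

  IncreasingPath : (V → ℕ) → (ℕ → V) → Set
  IncreasingPath κ p = (∀ i → E (p i) (p (suc i))) × (∀ i → κ (p i) < κ (p (suc i)))

  -- An order of type ω without increasing rays inside U; fewOutside makes tameness pass
  -- to countable unions.
  record Tame (U : V → Set) : Set where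
    field
      fewOutside : ∀ {x} → U x → Finite (λ y → E x y × ¬ U y)
      order      : V → ℕ
      injective  : Injective _≡_ _≡_ order
      noPath     : ∀ p → (∀ i → U (p i)) → ¬ IncreasingPath order p

-- Classical facts about natural numbers

module Classical (em : ExcludedMiddle 0ℓ) where

  least : (P : ℕ → Set) → ∃ P → ∃[ n ] (P n × (∀ m → P m → n ≤ m))
  least P (n , Pn) = go n Pn (<-wellFounded n)
    where
    go : ∀ n → P n → Acc _<_ n → ∃[ n ] (P n × (∀ m → P m → n ≤ m))
    go n Pn (acc rs) with em {∃[ m ] (m < n × P m)}
    ... | yes (m , m<n , Pm) = go m Pm (rs m<n)
    ... | no none = n , Pn , λ m Pm → ≮⇒≥ (λ m<n → none (m , m<n , Pm))

  -- Take `k` to be an index where `f` attains its least value.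
  antitone⇒stable : (f : ℕ → ℕ) → (∀ i → f (suc i) ≤ f i) → ∃[ k ] (∀ i → f (i + k) ≡ f k)
  antitone⇒stable f f≥ with least (λ n → ∃[ k ] f k ≡ n) (f 0 , 0 , refl)
  ... | _ , (k , refl) , min = k , λ i → ≤-antisym (below i) (min _ (i + k , refl))
    where
    below : ∀ i → f (i + k) ≤ f k
    below zero    = ≤-refl
    below (suc i) = ≤-trans (f≥ (i + k)) (below i)

  finite-below : {V : Set} {S : V → Set} (κ : V → ℕ) →
    (∀ {u v} → S u → S v → κ u ≡ κ v → u ≡ v) →
    ∀ n → Finite (λ v → S v × κ v < n)
  finite-below κ inj zero = [] , λ ()
  finite-below {V} {S} κ inj (suc n) with finite-below κ inj n | em {Σ V λ v → S v × κ v ≡ n}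
  ... | xs , in-xs | yes (w , Sw , κw≡n) = w ∷ xs , cover
    where
    cover : ∀ {v} → S v × κ v < suc n → v ∈ w ∷ xs
    cover {v} (Sv , s≤s κv≤n) with m≤n⇒m<n∨m≡n κv≤n
    ... | inj₁ κv<n = there (in-xs (Sv , κv<n))
    ... | inj₂ κv≡n = here (inj Sv Sw (trans κv≡n (sym κw≡n)))
  ... | xs , in-xs | no none = xs , cover
    where
    cover : ∀ {v} → S v × κ v < suc n → v ∈ xs
    cover {v} (Sv , s≤s κv≤n) with m≤n⇒m<n∨m≡n κv≤n
    ... | inj₁ κv<n = in-xs (Sv , κv<n)
    ... | inj₂ κv≡n = contradiction (v , Sv , κv≡n) none

  -- Interleaves orders π n of the level sets into one order of type ω: vertices
  -- enter in finite stages, within a stage high levels come first.  Stage t is closed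
  -- under upward edges from levels below g t, and g (suc t) exceeds the level of every
  -- upward neighbour of stage t.  Hence no increasing edge crosses a cut g t upwards.
  module Interleave {V : Set} (E : V → V → Set) (level : V → ℕ) (π : ℕ → V → ℕ)
    (π-injective : ∀ n → Injective _≡_ _≡_ (π n))
    (few-up : ∀ x → Finite (λ y → E x y × level x < level y)) where

    -- Growth of sizes along upward edges

    pos : V → ℕ
    pos x = π (level x) x

    size : V → ℕ
    size x = level x ⊔ pos x

    -- By injectivity of `π n`, a level and a position determine at most one vertex. The value 0 at
    -- unoccupied pairs is arbitrary.
    upSize : ℕ → ℕ → ℕ
    upSize n i with em {Σ V λ x → level x ≡ n × pos x ≡ i}
    ... | yes (x , _) = maxOver size (proj₁ (few-up x))
    ... | no _        = 0

    upSize-bound : ∀ {x y} → E x y → level x < level y → size y ≤ upSize (level x) (pos x)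
    upSize-bound {x} {y} xy x<y with em {Σ V λ z → level z ≡ level x × pos z ≡ pos x}
    ... | no none = contradiction (x , refl , refl) none
    ... | yes (z , lz≡lx , pz≡px) =
      ∈⇒≤maxOver size (proj₂ (few-up z) (subst (λ w → E w y × level w < level y) (sym z≡x) (xy , x<y)))
      where
      z≡x : z ≡ x
      z≡x = π-injective (level x) (trans (cong (λ n → π n z) (sym lz≡lx)) pz≡px)

    -- A vertex of size at most `k` has level and position at most `k`, so this finite double
    -- supremum accounts for all such vertices.
    M₀ : ℕ → ℕ
    M₀ k = sup (λ n → sup (upSize n) k) k

    -- The running supremum makes the bound monotone and the join with `k` makes it inflationary, so
    -- that it can be iterated.
    M : ℕ → ℕ
    M k = k ⊔ sup M₀ k

    M-inflationary : ∀ k → k ≤ M k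
    M-inflationary k = m≤m⊔n k (sup M₀ k)

    M-mono : ∀ {k l} → k ≤ l → M k ≤ M l
    M-mono k≤l = ⊔-mono-≤ k≤l (step⇒mono (sup M₀) (sup-step M₀) k≤l)

    M-bound : ∀ {x y} → E x y → level x < level y → size y ≤ M (size x)
    M-bound {x} {y} xy x<y = begin
      size y                                       ≤⟨ upSize-bound xy x<y ⟩
      upSize (level x) (pos x)                     ≤⟨ sup-upper (upSize (level x)) (m≤n⊔m (level x) (pos x)) ⟩
      sup (upSize (level x)) (size x)              ≤⟨ sup-upper (λ n → sup (upSize n) (size x)) (m≤m⊔n (level x) (pos x)) ⟩
      M₀ (size x)                                  ≤⟨ sup-upper M₀ {size x} ≤-refl ⟩
      sup M₀ (size x)                              ≤⟨ m≤n⊔m (size x) _ ⟩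
      M (size x)                                   ∎
      where open ≤-Reasoning

    M^ : ℕ → ℕ → ℕ
    M^ zero    k = k
    M^ (suc n) k = M (M^ n k)

    M^-mono : ∀ k {m n} → m ≤ n → M^ m k ≤ M^ n k
    M^-mono k = step⇒mono (λ n → M^ n k) (λ n → M-inflationary (M^ n k))

    -- The inner iterate is `Z t`, a bound for the sizes in stage `t`; one more `M` bounds their
    -- upward neighbours, and `suc` makes this strict. The initial value 1 leaves exactly level 0
    -- below the first cut.
    g : ℕ → ℕ
    g zero    = 1
    g (suc t) = suc (M (M^ (g t) (g t)))

    Z : ℕ → ℕ
    Z t = M^ (g t) (g t)

    g-step : ∀ t → g t < g (suc t)
    g-step t = s≤s (≤-trans (M^-mono (g t) {0} {g t} z≤n) (M-inflationary (Z t)))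

    g-mono : ∀ {s t} → s ≤ t → g s ≤ g t
    g-mono = step⇒mono g (<⇒≤ ∘ g-step)

    n<g : ∀ n → n < g n
    n<g zero    = s≤s z≤n
    n<g (suc n) = ≤-<-trans (n<g n) (g-step n)

    -- Iterating M once per level makes stage t = { x | size x ≤ threshold t (level x) } closed
    -- under upward edges from levels below g t.
    threshold : ℕ → ℕ → ℕ
    threshold t n = M^ (n ⊓ g t) (g t)

    size≤threshold : ∀ x → size x ≤ threshold (size x) (level x)
    size≤threshold x =
      ≤-trans (<⇒≤ (n<g (size x))) (M^-mono (g (size x)) {0} {level x ⊓ g (size x)} z≤n)

    least-stage : ∀ x → ∃[ t ] (size x ≤ threshold t (level x) ×
                                (∀ s → size x ≤ threshold s (level x) → t ≤ s))
    least-stage x = least (λ t → size x ≤ threshold t (level x)) (size x , size≤threshold x)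

    stage : V → ℕ
    stage x = proj₁ (least-stage x)

    size≤ : ∀ x → size x ≤ threshold (stage x) (level x)
    size≤ x = proj₁ (proj₂ (least-stage x))

    stage≤ : ∀ x {t} → size x ≤ threshold t (level x) → stage x ≤ t
    stage≤ x = proj₂ (proj₂ (least-stage x)) _

    size≤Z : ∀ x → size x ≤ Z (stage x)
    size≤Z x = ≤-trans (size≤ x) (M^-mono (g (stage x)) (m⊓n≤n (level x) (g (stage x))))

    -- The interleaved order

    C : ℕ → ℕ
    C zero    = 0
    C (suc t) = C t + suc (Z t) * suc (Z t)

    C-mono : ∀ {s t} → s ≤ t → C s ≤ C t
    C-mono = step⇒mono C (λ t → m≤m+n (C t) _)

    -- A two-digit number in base `suc (Z t)`, shifted by the start `C t` of the block of stage `t`.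
    -- The leading digit is the reversed level, the last digit the position. For vertices of stage
    -- `t` both digits are at most `Z t`, so different stages occupy disjoint blocks.
    keyAt : ℕ → V → ℕ
    keyAt t x = C t + ((Z t ∸ level x) * suc (Z t) + pos x)

    key : V → ℕ
    key x = keyAt (stage x) x

    C≤key : ∀ x → C (stage x) ≤ key x
    C≤key x = m≤m+n (C (stage x)) _

    level≤Z : ∀ x → level x ≤ Z (stage x)
    level≤Z x = ≤-trans (m≤m⊔n (level x) (pos x)) (size≤Z x)

    pos≤Z : ∀ x → pos x ≤ Z (stage x)
    pos≤Z x = ≤-trans (m≤n⊔m (level x) (pos x)) (size≤Z x)

    key<C : ∀ x → key x < C (suc (stage x))
    key<C x = +-monoʳ-< (C (stage x)) (begin-strict
      (z ∸ level x) * suc z + pos x   <⟨ +-mono-≤-< (*-monoˡ-≤ (suc z) (m∸n≤m z (level x))) (s≤s (pos≤Z x)) ⟩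
      z * suc z + suc z               ≡⟨ +-comm (z * suc z) (suc z) ⟩
      suc z * suc z                   ∎)
      where
      open ≤-Reasoning
      z = Z (stage x)

    stage-mono : ∀ {x y} → key x ≤ key y → stage x ≤ stage y
    stage-mono {x} {y} kx≤ky = ≮⇒≥ λ y<x →
      <⇒≱ (key<C y) (≤-trans (C-mono y<x) (≤-trans (C≤key x) kx≤ky))

    higher-first : ∀ {x y} → stage x ≡ stage y → level x < level y → key y < key x
    higher-first {x} {y} sx≡sy x<y =
      subst (λ t → key y < keyAt t x) (sym sx≡sy) (+-monoʳ-< (C t) (begin-strict
      (z ∸ level y) * suc z + pos y   <⟨ +-monoʳ-< ((z ∸ level y) * suc z) (s≤s (pos≤Z y)) ⟩
      (z ∸ level y) * suc z + suc z   ≡⟨ +-comm ((z ∸ level y) * suc z) (suc z) ⟩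
      -- The bound `level≤Z y` prevents truncation, so the leading digit really drops.
      suc (z ∸ level y) * suc z       ≤⟨ *-monoˡ-≤ (suc z) (∸-monoʳ-< x<y (level≤Z y)) ⟩
      (z ∸ level x) * suc z           ≤⟨ m≤m+n _ (pos x) ⟩
      (z ∸ level x) * suc z + pos x   ∎))
      where
      open ≤-Reasoning
      t = stage y
      z = Z t

    key-injective : Injective _≡_ _≡_ key
    key-injective {x} {y} kx≡ky = π-injective (level x) (trans pos≡ (cong (λ n → π n y) (sym level≡)))
      where
      stage≡ : stage x ≡ stage y
      stage≡ = ≤-antisym (stage-mono (≤-reflexive kx≡ky)) (stage-mono (≤-reflexive (sym kx≡ky)))
      level≡ : level x ≡ level y
      level≡ with <-cmp (level x) (level y)
      ... | tri≈ _ eq _ = eq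
      ... | tri< x<y _ _ = contradiction (sym kx≡ky) (<⇒≢ (higher-first stage≡ x<y))
      ... | tri> _ _ y<x = contradiction kx≡ky (<⇒≢ (higher-first (sym stage≡) y<x))
      z = Z (stage y)
      pos≡ : pos x ≡ pos y
      pos≡ = +-cancelˡ-≡ ((z ∸ level y) * suc z) _ _ (+-cancelˡ-≡ (C (stage y)) _ _
        (subst (λ n → C (stage y) + ((z ∸ n) * suc z + pos x) ≡ key y) level≡
          (subst (λ t → keyAt t x ≡ key y) stage≡ kx≡ky)))

    -- On one level the thresholds agree, so a vertex with smaller or equal position enters no
    -- later. Within a common stage the leading digits cancel.
    key<⇒pos< : ∀ {x y} → level x ≡ level y → key x < key y → pos x < pos y
    key<⇒pos< {x} {y} level≡ kx<ky with m≤n⇒m<n∨m≡n (stage-mono (<⇒≤ kx<ky))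
    ... | inj₁ sx<sy = ≰⇒> λ py≤px → <⇒≱ sx<sy (stage≤ y (begin
      size y                           ≤⟨ ⊔-mono-≤ (≤-reflexive (sym level≡)) py≤px ⟩
      size x                           ≤⟨ size≤ x ⟩
      threshold (stage x) (level x)    ≡⟨ cong (threshold (stage x)) level≡ ⟩
      threshold (stage x) (level y)    ∎))
      where open ≤-Reasoning
    ... | inj₂ sx≡sy = +-cancelˡ-< ((z ∸ level y) * suc z) _ _ (+-cancelˡ-< (C (stage y)) _ _
        (subst (λ n → C (stage y) + ((z ∸ n) * suc z + pos x) < key y) level≡
          (subst (λ t → keyAt t x < key y) sx≡sy kx<ky)))
      where z = Z (stage y)

    -- Increasing paths and cuts

    -- If `level x` were below `g (stage x)`, closure of the stage would put `y` into the same
    -- stage, where the higher level comes first, against `key x < key y`. The upper bound is what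
    -- `g` was defined for.
    climb : ∀ {x y} → E x y → key x < key y → level x < level y →
      g (stage x) ≤ level x × level y < g (suc (stage x))
    climb {x} {y} xy kx<ky x<y = ≮⇒≥ early , s≤s (begin
      level y          ≤⟨ m≤m⊔n (level y) (pos y) ⟩
      size y           ≤⟨ M-bound xy x<y ⟩
      M (size x)       ≤⟨ M-mono (size≤Z x) ⟩
      M (Z (stage x))  ∎)
      where
      open ≤-Reasoning
      t = stage x
      early : ¬ (level x < g t)
      early x<g = <-asym kx<ky (higher-first (≤-antisym (stage-mono (<⇒≤ kx<ky)) sy≤sx) x<y)
        where
        sy≤sx : stage y ≤ t
        sy≤sx = stage≤ y (begin
          size y                        ≤⟨ M-bound xy x<y ⟩
          M (size x)                    ≤⟨ M-mono (size≤ x) ⟩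
          M (M^ (level x ⊓ g t) (g t))  ≤⟨ M-mono (M^-mono (g t) (m⊓n≤m (level x) (g t))) ⟩
          -- The extra `M` is paid for by the level: `suc (level x)` is at most both `level y` and
          -- `g t`.
          M^ (suc (level x)) (g t)      ≤⟨ M^-mono (g t) (⊓-glb x<y x<g) ⟩
          threshold t (level y)         ∎)

    -- If the edge climbs, then `g (stage x) ≤ level x < g j` forces `stage x < j`, hence
    -- `level y < g (suc (stage x)) ≤ g j`.
    below-cut : ∀ {x y} j → E x y → key x < key y → level x < g j → level y < g j
    below-cut {x} {y} j xy kx<ky x<g with <-≤-connex (level x) (level y)
    ... | inj₂ y≤x = ≤-<-trans y≤x x<g
    ... | inj₁ x<y with climb xy kx<ky x<y
    ... | g≤x , y<g = <-≤-trans y<g (g-mono (≰⇒> λ j≤t → <⇒≱ (≤-<-trans g≤x x<g) (g-mono j≤t)))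

    key⇒π : ∀ {n p} → (∀ i → level (p i) ≡ n) → IncreasingPath E key p → IncreasingPath E (π n) p
    key⇒π {n} {p} levels (edges , increasing) = edges , λ i →
      subst₂ (λ k l → π k (p i) < π l (p (suc i))) (levels i) (levels (suc i))
        (key<⇒pos< (trans (levels i) (sym (levels (suc i)))) (increasing i))

    stays-below-cut : ∀ {p} j → IncreasingPath E key p → level (p 0) < g j → ∀ i → level (p i) < g j
    stays-below-cut j path start zero = start
    stays-below-cut j path@(edges , increasing) start (suc i) =
      below-cut j (edges i) (increasing i) (stays-below-cut j path start i)

    -- Below the cut g j, beyond stage j the level can no longer increase.
    noPath : (∀ n p → (∀ i → level (p i) ≡ n) → ¬ IncreasingPath E (π n) p) →
      ∀ p → ¬ IncreasingPath E key p
    noPath noLevelPath p path@(edges , increasing) =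
      noLevelPath _ (λ i → late (i + k)) constant
        (key⇒π constant ((λ i → edges (i + k + C j)) , λ i → increasing (i + k + C j)))
      where
      j = level (p 0)
      -- Keys grow by at least one per step, so after `C j` steps the path has left all blocks of
      -- stages below `j`.
      late : ℕ → V
      late i = p (i + C j)
      j≤stage : ∀ i → j ≤ stage (late i)
      j≤stage i = ≮⇒≥ λ stage<j → <⇒≱ (key<C (late i)) (begin
        C (suc (stage (late i)))  ≤⟨ C-mono stage<j ⟩
        C j                       ≤⟨ m≤n+m (C j) i ⟩
        i + C j                   ≤⟨ step⇒≥ (key ∘ p) increasing (i + C j) ⟩
        key (late i)              ∎)
        where open ≤-Reasoning
      antitone : ∀ i → level (late (suc i)) ≤ level (late i)
      antitone i = ≮⇒≥ λ up → <⇒≱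
        (stays-below-cut j path (n<g j) (i + C j))
        (≤-trans (g-mono (j≤stage i)) (proj₁ (climb (edges (i + C j)) (increasing (i + C j)) up)))
      stable = antitone⇒stable (level ∘ late) antitone
      k = proj₁ stable
      constant : ∀ i → level (late (i + k)) ≡ level (late k)
      constant = proj₂ stable

  -- Construction of tame sets

  module _ {V : Set} (E : V → V → Set) where
    open Tame

    -- The level of a vertex is the least index of a set containing it. An upward neighbour of `x`
    -- therefore lies outside `U (level x)`, and `fewOutside` leaves only finitely many of these.
    ⋃-tame : (U : ℕ → V → Set) → (∀ n → Tame E (U n)) → Tame E (λ x → ∃[ n ] U n x)
    ⋃-tame U tame = record
      { fewOutside = λ (n , Unx) → let xs , in-xs = fewOutside (tame n) Unx in
          xs , λ (xy , y∉) → in-xs (xy , λ Uny → y∉ (n , Uny))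
      ; order      = key
      ; injective  = key-injective
      ; noPath     = λ p inside (edges , increasing) → I.noPath
          (λ n q levels (edges′ , increasing′) → noPath (tame n) q
            (λ i → subst (λ l → U l (q i)) (levels i) (in-level (proj₁ (edges′ i))))
            ((λ i → proj₂ (proj₂ (edges′ i))) , increasing′))
          p ((λ i → inside i , inside (suc i) , edges i) , increasing)
      }
      where
      ⋃U : V → Set
      ⋃U x = ∃[ n ] U n x
      level : V → ℕ
      level x with em {⋃U x}
      ... | yes x∈ = proj₁ (least (λ n → U n x) x∈)
      ... | no _   = 0
      in-level : ∀ {x} → ⋃U x → U (level x) x
      in-level {x} x∈ with em {⋃U x}
      ... | yes x∈′ = proj₁ (proj₂ (least (λ n → U n x) x∈′))
      ... | no x∉  = contradiction x∈ x∉
      level-least : ∀ {x n} → U n x → level x ≤ n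
      level-least {x} {n} Unx with em {⋃U x}
      ... | yes x∈ = proj₂ (proj₂ (least (λ n → U n x) x∈)) n Unx
      ... | no _   = z≤n
      -- Membership in the union is built into the edges: vertices outside it, whose level is the
      -- default 0, get no edges, and a path on level `n` lies in `U n`.
      E′ : V → V → Set
      E′ x y = ⋃U x × ⋃U y × E x y
      few-up : ∀ x → Finite (λ y → E′ x y × level x < level y)
      few-up x with em {⋃U x}
      ... | no x∉ = [] , λ ((x∈ , _) , _) → contradiction x∈ x∉
      ... | yes x∈ with fewOutside (tame _) (proj₁ (proj₂ (least (λ n → U n x) x∈)))
      ... | xs , in-xs = xs , λ ((_ , _ , xy) , x<y) → in-xs (xy , λ Uy → <⇒≱ x<y (level-least Uy))
      module I = Interleave E′ level (λ n → order (tame n)) (λ n → injective (tame n)) few-up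
      open I using (key; key-injective)

    -- Since `v` comes first, an increasing path can meet it only at its start; the tail is an
    -- increasing path inside `U`.
    insert-tame : ∀ {U v} → Tame E U → Finite (λ y → E v y × ¬ U y) → Tame E (λ x → x ≡ v ⊎ U x)
    insert-tame {U} {v} tame (vs , in-vs) = record
      { fewOutside = few
      ; order      = ord
      ; injective  = inj
      ; noPath     = λ p inside (edges , increasing) → noPath tame (p ∘ suc)
          (λ i → [ (λ eq → contradiction eq (later (increasing i))) , (λ Ux → Ux) ]′ (inside (suc i)))
          (edges ∘ suc , λ i → reflect (later (increasing i)) (increasing (suc i)))
      }
      where
      few : ∀ {x} → x ≡ v ⊎ U x → Finite (λ y → E x y × ¬ (y ≡ v ⊎ U y))
      few (inj₁ refl) = vs , λ (vy , y∉) → in-vs (vy , y∉ ∘ inj₂)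
      few (inj₂ Ux) with fewOutside tame Ux
      ... | xs , in-xs = xs , λ (xy , y∉) → in-xs (xy , y∉ ∘ inj₂)
      ord : V → ℕ
      ord x with em {x ≡ v}
      ... | yes _ = 0
      ... | no _  = suc (order tame x)
      inj : Injective _≡_ _≡_ ord
      inj {x} {y} eq with em {x ≡ v} | em {y ≡ v}
      ... | yes x≡v | yes y≡v = trans x≡v (sym y≡v)
      ... | no _    | no _    = injective tame (suc-injective eq)
      later : ∀ {x y} → ord x < ord y → y ≢ v
      later {x} {y} x<y with em {y ≡ v}
      ... | no y≢v = y≢v
      reflect : ∀ {x y} → x ≢ v → ord x < ord y → order tame x < order tame y
      reflect {x} {y} x≢v x<y with em {x ≡ v} | em {y ≡ v}
      ... | yes x≡v | _    = contradiction x≡v x≢v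
      ... | no _    | no _ = s<s⁻¹ x<y

    ∅-tame : (κ : V → ℕ) → Injective _≡_ _≡_ κ → Tame E (λ _ → ⊥)
    ∅-tame κ κ-injective = record
      { fewOutside = λ ()
      ; order      = κ
      ; injective  = κ-injective
      ; noPath     = λ p inside _ → inside 0
      }

    module _ (enum : CountablyInfinite V) where
      open Bijection enum using (to; surjective) renaming (injective to to-injective)

      from : ℕ → V
      from n = proj₁ (surjective n)

      from-to : ∀ v → from (to v) ≡ v
      from-to v = to-injective (proj₂ (surjective (to v)) refl)

      TameNbhd : V → Set₁
      TameNbhd v = Σ (V → Set) λ U → U v × Tame E U

      -- Countability of `V` turns the family into a sequence; vertices outside `P` contribute the
      -- empty set.
      ⋃-family : (P : V → Set) → (∀ v → P v → TameNbhd v) →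
        Σ (V → Set) λ U → (∀ {v} → P v → U v) × Tame E U
      ⋃-family P nbhd = (λ x → ∃[ n ] proj₁ (family n) x) , covers , ⋃-tame _ (λ n → proj₁ (proj₂ (family n)))
        where
        at : ∀ v → Σ (V → Set) λ U → Tame E U × (P v → U v)
        at v with em {P v}
        ... | yes Pv = let U , Uv , tame = nbhd v Pv in U , tame , λ _ → Uv
        ... | no ¬Pv = (λ _ → ⊥) , ∅-tame to to-injective , ¬Pv
        family : ∀ n → Σ (V → Set) λ U → Tame E U × (P (from n) → U (from n))
        family n = at (from n)
        covers : ∀ {v} → P v → ∃[ n ] proj₁ (family n) v
        covers {v} Pv = to v , subst (λ w → proj₁ (at w) v) (sym (from-to v)) (proj₂ (proj₂ (at v)) Pv)

      -- Induction on the derivation of thinness. The union of the tame sets around the neighbours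
      -- outside `xs` covers those neighbours, so `v` has all its uncovered neighbours in `xs` and
      -- can be inserted.
      thin⇒tameNbhd : ∀ {v} → Thin E v → TameNbhd v
      thin⇒tameNbhd {v} (thin xs rest)
        with ⋃-family (λ u → E v u × u ∉ xs) (λ u (vu , u∉xs) → thin⇒tameNbhd (rest u vu u∉xs))
      ... | U , covers , tame = (λ x → x ≡ v ⊎ U x) , inj₁ refl ,
        insert-tame tame (xs , λ (vu , u∉U) → decidable-stable em λ u∉xs → u∉U (covers (vu , u∉xs)))

      thin-few : ∀ {v} → Thin E v → Finite (λ u → E v u × ¬ Thin E u)
      thin-few (thin xs rest) = xs , λ (vu , thick) → decidable-stable em λ u∉xs → thick (rest _ vu u∉xs)

      -- Interleave two levels, thin vertices on 0 and the others on 1, both ordered by one tame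
      -- order for a set covering the thin vertices.
      thick-start : Σ (V → ℕ) λ κ → Injective _≡_ _≡_ κ ×
        (∀ p → IncreasingPath E κ p → ¬ Thin E (p 0))
      thick-start = I.key , I.key-injective , λ p path thin₀ →
        -- As `g 0` is 1, the cut 0 separates the two levels, so a path with a thin start stays
        -- thin.
        let levels = λ i → n<1⇒n≡0 (I.stays-below-cut 0 path (s≤s (≤-reflexive (thin⇒level thin₀))) i)
        in noPath tame p (λ i → covers (level⇒thin (levels i))) (I.key⇒π levels path)
        where
        thin-tame = ⋃-family (Thin E) (λ _ → thin⇒tameNbhd)
        covers = proj₁ (proj₂ thin-tame)
        tame = proj₂ (proj₂ thin-tame)
        level : V → ℕ
        level x with em {Thin E x}
        ... | yes _ = 0
        ... | no _  = 1
        thin⇒level : ∀ {x} → Thin E x → level x ≡ 0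
        thin⇒level {x} thin-x with em {Thin E x}
        ... | yes _    = refl
        ... | no thick = contradiction thin-x thick
        level⇒thin : ∀ {x} → level x ≡ 0 → Thin E x
        level⇒thin {x} eq with em {Thin E x}
        ... | yes thin-x = thin-x
        few-up : ∀ x → Finite (λ y → E x y × level x < level y)
        few-up x with em {Thin E x}
        ... | yes thin-x = let xs , in-xs = thin-few thin-x in
          xs , λ (xy , up) → in-xs (xy , λ thin-y → n≮0 (subst (0 <_) (thin⇒level thin-y) up))
        ... | no _ = [] , λ (_ , up) → contradiction (level≤1 _) (<⇒≱ up)
          where
          level≤1 : ∀ y → level y ≤ 1
          level≤1 y with em {Thin E y}
          ... | yes _ = z≤n
          ... | no _  = ≤-refl
        module I = Interleave E level (λ _ → order tame) (λ _ → injective tame) few-up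

  -- Renumbering an infinite subset by consecutive ranks

  module Ranking {V : Set} {S : V → Set} (infinite : Infinite S) (κ : V → ℕ)
    (κ-injective : Injective _≡_ _≡_ κ) where

    Hit : ℕ → Set
    Hit m = Σ V λ v → S v × κ v ≡ m

    -- The number of values below the argument that `κ` takes on `S`.
    count : ℕ → ℕ
    count zero = 0
    count (suc m) with em {Hit m}
    ... | yes _ = suc (count m)
    ... | no _  = count m

    count-hit : ∀ {m} → Hit m → count (suc m) ≡ suc (count m)
    count-hit {m} hit with em {Hit m}
    ... | yes _  = refl
    ... | no ¬hit = contradiction hit ¬hit

    count-miss : ∀ {m} → ¬ Hit m → count (suc m) ≡ count m
    count-miss {m} ¬hit with em {Hit m}
    ... | yes hit = contradiction hit ¬hit
    ... | no _  = refl

    count-mono : ∀ {m n} → m ≤ n → count m ≤ count n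
    count-mono = step⇒mono count step
      where
      step : ∀ n → count n ≤ count (suc n)
      step n with em {Hit n}
      ... | yes _ = n≤1+n _
      ... | no _  = ≤-refl

    rank : V → ℕ
    rank v = count (κ v)

    rank<⇒κ< : ∀ {u v} → rank u < rank v → κ u < κ v
    rank<⇒κ< ru<rv = ≰⇒> λ κv≤κu → <⇒≱ ru<rv (count-mono κv≤κu)

    κ<⇒rank< : ∀ {u v} → S u → κ u < κ v → rank u < rank v
    κ<⇒rank< {u} Su κu<κv = subst (_≤ _) (count-hit (u , Su , refl)) (count-mono κu<κv)

    rank-injective : ∀ {u v} → S u → S v → rank u ≡ rank v → u ≡ v
    rank-injective {u} {v} Su Sv ru≡rv with <-cmp (κ u) (κ v)
    ... | tri≈ _ κu≡κv _ = κ-injective κu≡κv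
    ... | tri< κu<κv _ _ = contradiction ru≡rv (<⇒≢ (κ<⇒rank< Su κu<κv))
    ... | tri> _ _ κv<κu = contradiction (sym ru≡rv) (<⇒≢ (κ<⇒rank< Sv κv<κu))

    hit-beyond : ∀ m → ∃[ d ] Hit (d + m)
    hit-beyond m = decidable-stable em λ none →
      let xs , in-xs = finite-below {S = S} κ (λ _ _ → κ-injective) m in
      infinite (xs , λ {v} Sv → in-xs (Sv , ≰⇒> λ m≤κv →
        none (κ v ∸ m , v , Sv , sym (m∸n+n≡m m≤κv))))

    -- Misses leave `count` unchanged, so the first hit from `m` on has rank `count m`; `d` bounds
    -- the search.
    next-hit : ∀ d m → Hit (d + m) → ∃[ v ] (S v × rank v ≡ count m)
    next-hit zero m (v , Sv , κv≡m) = v , Sv , cong count κv≡m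
    next-hit (suc d) m hit with em {Hit m}
    ... | yes (v , Sv , κv≡m) = v , Sv , cong count κv≡m
    ... | no ¬hit with next-hit d (suc m) (subst Hit (sym (+-suc d m)) hit)
    ... | v , Sv , eq = v , Sv , trans eq (count-miss ¬hit)

    rank-surjective : ∀ n → ∃[ v ] (S v × rank v ≡ n)
    rank-surjective zero = let d , hit = hit-beyond 0 in next-hit d 0 hit
    rank-surjective (suc n) with rank-surjective n
    -- Just after `κ v` the count is one more than the rank of `v`.
    ... | v , Sv , refl with hit-beyond (suc (κ v))
    ... | d , hit with next-hit d (suc (κ v)) hit
    ... | w , Sw , eq = w , Sw , trans eq (count-hit (v , Sv , refl))

  -- Condition (2) implies condition (1)

  module _ {V : Set} (G : Graph V) where
    open Graph G renaming (sym to E-sym)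

    -- Labels the two colour classes by ℕ and by the negative integers, so that an increasing
    -- two-sided path changes class exactly once.
    module ColourLabeling (enum : CountablyInfinite V) (c : V → Bool) (infinite : ∀ b → Infinite (λ v → c v ≡ b)) where

      Side : Bool → V → V → Set
      Side b u v = E u v × c u ≡ b × c v ≡ b

      Thick : Bool → V → Set
      Thick b v = ¬ Thin (Side b) v

      -- A vertex of the other colour has no `Side b` edges, hence is thin with an empty exception
      -- list.
      thick⇒side : ∀ b {v} → Thick b v → c v ≡ b
      thick⇒side b {v} thick = decidable-stable em λ cv≢b →
        thick (thin [] (λ _ (_ , cv≡b , _) → contradiction cv≡b cv≢b))

      -- A finite list of all thick neighbours would serve as an exception list for `thin`.
      thick-infiniteDegree : ∀ b → AllInfiniteDegree G (Thick b)
      thick-infiniteDegree b thick (xs , in-xs) =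
        thick (thin xs λ u (vu , _) u∉xs → decidable-stable em λ thick-u → u∉xs (in-xs (thick-u , vu)))

      order : Bool → V → ℕ
      order b = proj₁ (thick-start (Side b) enum)

      module R (b : Bool) =
        Ranking (infinite b) (order b) (proj₁ (proj₂ (thick-start (Side b) enum)))

      path⇒thick : ∀ b {p} → IncreasingPath (Side b) (order b) p → Thick b (p 0)
      path⇒thick b = proj₂ (proj₂ (thick-start (Side b) enum)) _

      -- Negative labels move away from 0 as the rank grows, so a path in the negative class
      -- increases in `order false` when read backwards.
      label : Bool → V → ℤ
      label true  v = + R.rank true v
      label false v = -[1+ R.rank false v ]

      φ : V → ℤ
      φ v = label (c v) v

      φ-side : ∀ {b v} → c v ≡ b → φ v ≡ label b v
      φ-side {v = v} = cong (λ b → label b v)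

      φ-injective : Injective _≡_ _≡_ φ
      φ-injective {u} {v} φu≡φv with c u in cu | c v in cv
      ... | true  | true  = R.rank-injective true cu cv (ℤ.+-injective φu≡φv)
      ... | false | false = R.rank-injective false cu cv (ℤ.-[1+-injective φu≡φv)
      ... | true  | false = contradiction φu≡φv λ ()
      ... | false | true  = contradiction φu≡φv λ ()

      φ-hits : ∀ z → ∃[ v ] φ v ≡ z
      φ-hits (+ n) = let v , cv , eq = R.rank-surjective true n in
        v , trans (φ-side cv) (cong +_ eq)
      φ-hits -[1+ n ] = let v , cv , eq = R.rank-surjective false n in
        v , trans (φ-side cv) (cong -[1+_] eq)

      labeling : Labeling V
      labeling = φ , φ-injective , λ z → proj₁ (φ-hits z) , λ { refl → proj₂ (φ-hits z) }

      0≤φ⇒true : ∀ {v} → 0ℤ ℤ.≤ φ v → c v ≡ true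
      0≤φ⇒true {v} 0≤φ with c v
      ... | true  = refl
      ... | false = contradiction 0≤φ λ ()

      φ<0⇒false : ∀ {v} → φ v ℤ.< 0ℤ → c v ≡ false
      φ<0⇒false {v} φ<0 with c v
      ... | false = refl
      φ<0⇒false {v} (+<+ ()) | true

      φ<⇒order< : ∀ {u v} → c u ≡ true → c v ≡ true → φ u ℤ.< φ v → order true u < order true v
      φ<⇒order< cu cv φu<φv =
        R.rank<⇒κ< true (ℤ.drop‿+<+ (subst₂ ℤ._<_ (φ-side cu) (φ-side cv) φu<φv))

      φ<⇒order> : ∀ {u v} → c u ≡ false → c v ≡ false → φ u ℤ.< φ v → order false v < order false u
      φ<⇒order> cu cv φu<φv =
        R.rank<⇒κ< false (ℤ.drop‿-<- (subst₂ ℤ._<_ (φ-side cu) (φ-side cv) φu<φv))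

      module Crossing (p : ℤ → V) (edges : ∀ i → E (p i) (p (i ℤ.+ 1ℤ)))
        (increasing : ∀ i → φ (p i) ℤ.< φ (p (i ℤ.+ 1ℤ))) where

        pred+1 : ∀ i → ℤ.pred i ℤ.+ 1ℤ ≡ i
        pred+1 i = trans (ℤ.+-comm (ℤ.pred i) 1ℤ) (ℤ.suc-pred i)

        increasing⁻ : ∀ i → φ (p (ℤ.pred i)) ℤ.< φ (p i)
        increasing⁻ i = subst (λ j → φ (p (ℤ.pred i)) ℤ.< φ (p j)) (pred+1 i) (increasing (ℤ.pred i))

        Crosses : ℤ → Set
        Crosses i = φ (p i) ℤ.< 0ℤ × 0ℤ ℤ.≤ φ (p (i ℤ.+ 1ℤ))

        -- While the label stays negative, each step forward lowers `n`, so the search ends;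
        -- `search-down` mirrors this.
        search-up : ∀ n i → φ (p i) ≡ -[1+ n ] → Acc _<_ n → ∃ Crosses
        search-up n i eq (acc rs) with φ (p (i ℤ.+ 1ℤ)) in eq′ | increasing i
        ... | + _      | _  = i , subst (ℤ._< 0ℤ) (sym eq) -<+ , subst (0ℤ ℤ.≤_) (sym eq′) (ℤ.+≤+ z≤n)
        ... | -[1+ m ] | lt = search-up m (i ℤ.+ 1ℤ) eq′
          (rs (ℤ.drop‿-<- (subst (ℤ._< -[1+ m ]) eq lt)))

        search-down : ∀ n i → φ (p i) ≡ + n → Acc _<_ n → ∃ Crosses
        search-down n i eq (acc rs) with φ (p (ℤ.pred i)) in eq′ | increasing⁻ i
        ... | + m      | lt = search-down m (ℤ.pred i) eq′ (rs (ℤ.drop‿+<+ (subst (+ m ℤ.<_) eq lt)))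
        ... | -[1+ _ ] | _  = ℤ.pred i , subst (ℤ._< 0ℤ) (sym eq′) -<+ ,
          subst (0ℤ ℤ.≤_) (trans (sym eq) (cong (φ ∘ p) (sym (pred+1 i)))) (ℤ.+≤+ z≤n)

        crossing : ∃ Crosses
        crossing with φ (p 0ℤ) in eq
        ... | + n      = search-down n 0ℤ eq (<-wellFounded n)
        ... | -[1+ n ] = search-up n 0ℤ eq (<-wellFounded n)

        forward : ℤ → ℕ → ℤ
        forward i zero    = i
        forward i (suc n) = forward i n ℤ.+ 1ℤ

        backward : ℤ → ℕ → ℤ
        backward i zero    = i
        backward i (suc n) = ℤ.pred (backward i n)

        -- Once the label is nonnegative the path never leaves the class `true`, so the rest is an
        -- increasing ray, and such rays start at thick vertices.
        forward-thick : ∀ i → 0ℤ ℤ.≤ φ (p i) → Thick true (p i)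
        forward-thick i 0≤φ = path⇒thick true {p ∘ forward i}
          ( (λ n → edges (forward i n) , side n , side (suc n))
          , (λ n → φ<⇒order< (side n) (side (suc n)) (increasing (forward i n))))
          where
          nonneg : ∀ n → 0ℤ ℤ.≤ φ (p (forward i n))
          nonneg zero    = 0≤φ
          nonneg (suc n) = ℤ.≤-trans (nonneg n) (ℤ.<⇒≤ (increasing (forward i n)))
          side : ∀ n → c (p (forward i n)) ≡ true
          side n = 0≤φ⇒true (nonneg n)

        backward-thick : ∀ i → φ (p i) ℤ.< 0ℤ → Thick false (p i)
        backward-thick i φ<0 = path⇒thick false {p ∘ backward i}
          ( (λ n → edge (backward i n) , side n , side (suc n))
          , (λ n → φ<⇒order> (side (suc n)) (side n) (increasing⁻ (backward i n))))
          where
          edge : ∀ j → E (p j) (p (ℤ.pred j))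
          edge j = E-sym (subst (λ k → E (p (ℤ.pred j)) (p k)) (pred+1 j) (edges (ℤ.pred j)))
          negative : ∀ n → φ (p (backward i n)) ℤ.< 0ℤ
          negative zero    = φ<0
          negative (suc n) = ℤ.<-trans (increasing⁻ (backward i n)) (negative n)
          side : ∀ n → c (p (backward i n)) ≡ false
          side n = φ<0⇒false (negative n)

    condition2⇒condition1 : CountablyInfinite V → Condition2 G → Condition1 G
    condition2⇒condition1 enum path c inf-true inf-false =
      let p , _ , edges , increasing = path labeling
          open Crossing p edges increasing
          i , φ<0 , 0≤φ = crossing
      in Thick true , Thick false , thick⇒side true , thick⇒side false ,
         thick-infiniteDegree true , thick-infiniteDegree false ,
         p (i ℤ.+ 1ℤ) , p i , forward-thick (i ℤ.+ 1ℤ) 0≤φ , backward-thick i φ<0 , E-sym (edges i)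
      where
      infinite : ∀ b → Infinite (λ v → c v ≡ b)
      infinite true  = inf-true
      infinite false = inf-false
      open ColourLabeling enum c infinite

    -- Condition (1) implies condition (2)

    module _ {W : V → Set} (infiniteDegree : AllInfiniteDegree G W) (ν : V → ℕ)
      (ν-injective : ∀ {u v} → W u → W v → ν u ≡ ν v → u ≡ v) where

      -- Only finitely many vertices of `W` have `ν` at most `ν w`, too few to contain all
      -- neighbours of `w` in `W`.
      grow : ∀ {w} → W w → Σ V λ u → W u × E w u × ν w < ν u
      grow {w} Ww = decidable-stable em λ none →
        let xs , in-xs = finite-below {S = W} ν ν-injective (suc (ν w)) in
        infiniteDegree Ww (xs , λ (Wu , wu) → in-xs (Wu , ≰⇒> λ νw<νu → none (_ , Wu , wu , νw<νu)))

      ray : ∀ {w} → W w → ℕ → Σ V W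
      ray {w} Ww zero = w , Ww
      ray Ww (suc n)  = let u , Wu , _ = grow (proj₂ (ray Ww n)) in u , Wu

      ray-edge : ∀ {w} (Ww : W w) n → E (proj₁ (ray Ww n)) (proj₁ (ray Ww (suc n)))
      ray-edge Ww n = proj₁ (proj₂ (proj₂ (grow (proj₂ (ray Ww n)))))

      ray-grows : ∀ {w} (Ww : W w) n → ν (proj₁ (ray Ww n)) < ν (proj₁ (ray Ww (suc n)))
      ray-grows Ww n = proj₂ (proj₂ (proj₂ (grow (proj₂ (ray Ww n)))))

      ray-injective : ∀ {w} (Ww : W w) {m n} → proj₁ (ray Ww m) ≡ proj₁ (ray Ww n) → m ≡ n
      ray-injective Ww eq = step⇒injective (λ n → ν (proj₁ (ray Ww n))) (ray-grows Ww) (cong ν eq)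

    twoSidedRay : ∀ {W₁ W₂ : V → Set} (φ : V → ℤ) → Injective _≡_ _≡_ φ →
      W₁ ⊆ (λ v → isNonNegative (φ v) ≡ true) → W₂ ⊆ (λ v → isNonNegative (φ v) ≡ false) →
      AllInfiniteDegree G W₁ → AllInfiniteDegree G W₂ →
      ∀ {w₁ w₂} → W₁ w₁ → W₂ w₂ → E w₁ w₂ → IncreasingTwoSidedPath G φ
    twoSidedRay {W₁} {W₂} φ φ-injective W₁⊆ W₂⊆ degree₁ degree₂ w₁∈ w₂∈ w₁w₂ =
      -- The auxiliary proofs use `ℤ.suc i`, since `1 + n` reduces to `suc n` while `n + 1` does
      -- not.
      p , p-injective , (λ i → subst (E (p i) ∘ p) (ℤ.+-comm 1ℤ i) (edge i)) ,
      (λ i → subst (λ j → φ (p i) ℤ.< φ (p j)) (ℤ.+-comm 1ℤ i) (increasing i))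
      where
      c : V → Bool
      c v = isNonNegative (φ v)

      ν : V → ℕ
      ν v = ∣ φ v ∣

      inj₊ : ∀ {u v} → W₁ u → W₁ v → ν u ≡ ν v → u ≡ v
      inj₊ Wu Wv = φ-injective ∘ ∣∣-injective true (W₁⊆ Wu) (W₁⊆ Wv)
      inj₋ : ∀ {u v} → W₂ u → W₂ v → ν u ≡ ν v → u ≡ v
      inj₋ Wu Wv = φ-injective ∘ ∣∣-injective false (W₂⊆ Wu) (W₂⊆ Wv)

      p : ℤ → V
      p (+ n)    = proj₁ (ray degree₁ ν inj₊ w₁∈ n)
      p -[1+ n ] = proj₁ (ray degree₂ ν inj₋ w₂∈ n)

      side₊ : ∀ n → c (p (+ n)) ≡ true
      side₊ n = W₁⊆ (proj₂ (ray degree₁ ν inj₊ w₁∈ n))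
      side₋ : ∀ n → c (p -[1+ n ]) ≡ false
      side₋ n = W₂⊆ (proj₂ (ray degree₂ ν inj₋ w₂∈ n))

      p-injective : Injective _≡_ _≡_ p
      p-injective {+ m}      {+ n}      eq = cong +_ (ray-injective degree₁ ν inj₊ w₁∈ eq)
      p-injective { -[1+ m ]} { -[1+ n ]} eq = cong -[1+_] (ray-injective degree₂ ν inj₋ w₂∈ eq)
      p-injective {+ m} { -[1+ n ]} eq =
        contradiction (trans (sym (side₊ m)) (trans (cong c eq) (side₋ n))) λ ()
      p-injective { -[1+ m ]} {+ n} eq =
        contradiction (trans (sym (side₊ n)) (trans (cong c (sym eq)) (side₋ m))) λ ()

      edge : ∀ i → E (p i) (p (ℤ.suc i))
      edge (+ n)          = ray-edge degree₁ ν inj₊ w₁∈ n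
      edge -[1+ zero ]    = E-sym w₁w₂
      edge -[1+ (suc n) ] = E-sym (ray-edge degree₂ ν inj₋ w₂∈ n)

      increasing : ∀ i → φ (p i) ℤ.< φ (p (ℤ.suc i))
      increasing (+ n) = ∣∣<⇒< (side₊ n) (side₊ (suc n)) (ray-grows degree₁ ν inj₊ w₁∈ n)
      increasing -[1+ zero ] = false<true (side₋ 0) (side₊ 0)
      -- Absolute values grow away from 0, so on the negative half the labels increase towards it.
      increasing -[1+ (suc n) ] = ∣∣<⇒> (side₋ n) (side₋ (suc n)) (ray-grows degree₂ ν inj₋ w₂∈ n)

    condition1⇒condition2 : Condition1 G → Condition2 G
    condition1⇒condition2 split (φ , φ-injective , φ-surjective) =
      let _ , _ , W₁⊆ , W₂⊆ , degree₁ , degree₂ , _ , _ , w₁∈ , w₂∈ , w₁w₂ =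
            split (isNonNegative ∘ φ) inf-true inf-false
      in twoSidedRay φ φ-injective W₁⊆ W₂⊆ degree₁ degree₂ w₁∈ w₂∈ w₁w₂
      where
      preimage : ∀ z → ∃[ v ] φ v ≡ z
      preimage z = proj₁ (φ-surjective z) , proj₂ (φ-surjective z) refl

      inf-true : Infinite (λ v → isNonNegative (φ v) ≡ true)
      inf-true = unbounded⇒infinite (∣_∣ ∘ φ) λ n → let v , eq = preimage (+ n) in
        v , cong isNonNegative eq , ≤-reflexive (sym (cong ∣_∣ eq))

      inf-false : Infinite (λ v → isNonNegative (φ v) ≡ false)
      inf-false = unbounded⇒infinite (∣_∣ ∘ φ) λ n → let v , eq = preimage -[1+ n ] in
        v , cong isNonNegative eq , ≤-trans (n≤1+n n) (≤-reflexive (sym (cong ∣_∣ eq)))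

theorem4p2 : ExcludedMiddle 0ℓ → (V : Set) → (G : Graph V) → CountablyInfinite V →
    Condition1 G ⇔ Condition2 G
theorem4p2 em V G enum = mk⇔ (condition1⇒condition2 G) (condition2⇒condition1 G enum)
  where open Classical em
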